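{- Let $C$ be a collage system of size $c$ (i.e., with $c$ rules) generating a string $T$. Then $T$ has a string attractor of size at most $c$.
   Context: A string attractor of a string $T$ of length $n$ is a set $\Gamma\subseteq\{1,\dots,n\}$ of positions such that every substring $T[i..j]$ has an occurrence $T[i'..j']=T[i..j]$ with $p\in[i',j']$ for some $p\in\Gamma$. A collage system is a finite set of rules, each defining a distinct nonterminal, of four types: $X\rightarrow a$ ($a$ a terminal character); $X\rightarrow AB$ with $A,B$ nonterminals different from $X$; $X\rightarrow R^{\ell}$ with $R\neq X$ a nonterminal and $\ell\ge 2$ (expansion of $X$ is the expansion of $R$ repeated $\ell$ times); $X\rightarrow K[l..r]$ with $K\neq X$ (expansion of $X$ is the substring from position $l$ to $r$ of the expansion of $K$). The system is acyclic: the derivation tree of any nonterminal $X$ contains neither $X$ nor any $X[l..r]$ as an internal node. The generated string is the expansion of a designated starting nonterminal $S$. -}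

module Defs where

open import Data.Nat using (ℕ; _+_; _∸_; _≤_)
open import Data.Fin using (Fin)
open import Data.List using (List; [_]; _++_; concat; replicate; take; drop; length)
open import Data.List.Membership.Propositional using (_∈_)
open import Data.Product using (Σ; _×_; ∃-syntax)
open import Relation.Binary.PropositionalEquality using (_≡_; _≢_)
open import Relation.Binary.Construct.Closure.Transitive using (TransClosure)
open import Relation.Nullary using (¬_)
open import Data.Unit using (⊤)

-- Substring T[i..j] with 1-based positions i..j (length j - i + 1).
substr : {A : Set} → List A → ℕ → ℕ → List A
substr T i j = take ((j ∸ i) + 1) (drop (i ∸ 1) T)

IsStringAttractor : {A : Set} → List A → List ℕ → Set
IsStringAttractor T Γ =
  (∀ {p} → p ∈ Γ → (1 ≤ p) × (p ≤ length T)) ×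
  (∀ i j → 1 ≤ i → i ≤ j → j ≤ length T →
     ∃[ i' ] ∃[ j' ] ((1 ≤ i') × (i' ≤ j') × (j' ≤ length T) ×
       (substr T i' j' ≡ substr T i j) ×
       ∃[ p ] ((p ∈ Γ) × (i' ≤ p) × (p ≤ j'))))

data Rule (A : Set) (c : ℕ) : Set where
  term  : A → Rule A c
  pair  : Fin c → Fin c → Rule A c
  power : Fin c → ℕ → Rule A c
  trunc : Fin c → ℕ → ℕ → Rule A c

RuleOK : {A : Set} {c : ℕ} → Fin c → Rule A c → Set
RuleOK X (term a)      = ⊤
RuleOK X (pair Y Z)    = (Y ≢ X) × (Z ≢ X)
RuleOK X (power R ℓ)   = (R ≢ X) × (2 ≤ ℓ)
RuleOK X (trunc K l r) = K ≢ X

data Refers {A : Set} {c : ℕ} (G : Fin c → Rule A c) : Fin c → Fin c → Set where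
  ref-pairˡ : ∀ {X Y Z} → G X ≡ pair Y Z → Refers G X Y
  ref-pairʳ : ∀ {X Y Z} → G X ≡ pair Y Z → Refers G X Z
  ref-power : ∀ {X R ℓ} → G X ≡ power R ℓ → Refers G X R
  ref-trunc : ∀ {X K l r} → G X ≡ trunc K l r → Refers G X K

Acyclic : {A : Set} {c : ℕ} → (Fin c → Rule A c) → Set
Acyclic G = ∀ X → ¬ TransClosure (Refers G) X X

record CollageSystem (A : Set) (c : ℕ) : Set where
  field
    rules   : Fin c → Rule A c
    start   : Fin c
    wf      : ∀ X → RuleOK X (rules X)
    acyclic : Acyclic rules

data Expands {A : Set} {c : ℕ} (G : Fin c → Rule A c) : Fin c → List A → Set where
  e-term  : ∀ {X a} → G X ≡ term a → Expands G X [ a ]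
  e-pair  : ∀ {X Y Z u v} → G X ≡ pair Y Z → Expands G Y u → Expands G Z v →
            Expands G X (u ++ v)
  e-power : ∀ {X R ℓ u} → G X ≡ power R ℓ → Expands G R u →
            Expands G X (concat (replicate ℓ u))
  e-trunc : ∀ {X K l r u} → G X ≡ trunc K l r → Expands G K u →
            1 ≤ l → l ≤ r → r ≤ length u → Expands G X (substr u l r)

Generates : {A : Set} {c : ℕ} → CollageSystem A c → List A → Set
Generates C T = Expands (CollageSystem.rules C) (CollageSystem.start C) T

{-# OPTIONS --safe #-}

-- A window of X is an occurrence in T of an infix w of the expansion of X = x w y; its weight is the number of
-- nonempty words among x and y. The rules are eliminated from the top, starting with the window T of weight 0
-- of the start symbol: the windows of X are replaced by windows of the symbols X refers to, and positions of T are
-- marked so that every infix of an old window is an infix of a new one or hits a mark. Doing this at a cost of at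
-- most 2 + (old weight) − (new weight) for two units per mark gives at most one mark per rule.
--
-- For X → AB each window across the cut is marked there; only the longest suffix of A and the longest prefix of B
-- remain, and since an antichain of k windows has at most one with x empty and at most one with y empty, its
-- weight pays for the k marks. The same antichain bound pays for the weight created by a truncation. For X → R^ℓ
-- with a full copy of R inside some window, either all left ends or all right ends are cut off, whichever are
-- fewer, and one more mark serves the remaining prefixes, or suffixes, of powers of R.
module Submission where

open import Defs
open import Data.Nat using (ℕ; zero; suc; _+_; _*_; _∸_; _≤_; _<_; z≤n; s≤s; _≤?_)
open import Data.Nat.Properties
open import Data.Nat.Tactic.RingSolver using (solve-∀)
open import Data.Fin using (Fin; zero; suc)
open import Data.Fin.Properties using (injective⇒≤) renaming (_≟_ to _≟ᶠ_)
open import Data.List using (List; []; _∷_; [_]; _++_; concat; replicate; take; drop; length; map; filter; lookup)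
open import Data.Nat.ListAction using (sum)
open import Data.Nat.ListAction.Properties using (sum-++)
open import Data.List.Properties hiding (sum-++)
open import Data.List.Extrema ≤-totalOrder using (argmin; argmax; f[argmin]≤f[⊤]; f[argmin]≤f[xs]; f[⊥]≤f[argmax]; f[xs]≤f[argmax])
open import Data.List.Membership.Propositional using (_∈_; _∉_; lose; find)
open import Data.List.Membership.Propositional.Properties using (∈-++⁺ˡ; ∈-++⁺ʳ; ∈-map⁺; ∈-map⁻; ∈-lookup; ∈-filter⁺; ∈-filter⁻)
open import Data.List.Relation.Binary.Subset.Propositional using (_⊆_)
open import Data.List.Relation.Binary.Subset.Propositional.Properties using (Any-resp-⊆)
open import Data.List.Relation.Unary.Unique.Propositional using (Unique)
open import Data.List.Membership.DecPropositional using () renaming (_∈?_ to member?)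
open import Data.List.Relation.Binary.Sublist.Propositional using ([]; _∷_; _∷ʳ_; ⊆-trans) renaming (_⊆_ to Sublist)
open import Data.List.Relation.Binary.Sublist.Propositional.Properties using (filter-⊆)
open import Data.List.Relation.Unary.All as All using (All; []; _∷_)
open import Data.List.Relation.Unary.All.Properties as All using (¬Any⇒All¬; all-filter)
open import Data.List.Relation.Unary.AllPairs as AllPairs using (AllPairs; []; _∷_)
import Data.List.Relation.Unary.AllPairs.Properties as AllPairs
open import Data.List.Relation.Unary.Any using (Any; here; there; any?)
open import Data.Product using (Σ; Σ-syntax; _×_; _,_; ∃-syntax; proj₁; proj₂)
open import Data.Sum using (_⊎_; inj₁; inj₂; [_,_]′)
open import Function using (_∘_; id)
open import Relation.Binary.PropositionalEquality using (_≡_; refl; sym; trans; cong; cong₂; subst; module ≡-Reasoning)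
open import Relation.Nullary using (¬_; Dec; yes; no; contradiction; ¬?; _×-dec_)

private variable
  A I : Set

-- Infixes, comparable affixes and cuts of words

Infix : List A → List A → Set
Infix z w = ∃[ a ] ∃[ b ] w ≡ a ++ z ++ b

++-reassoc : (a c z d b : List A) → a ++ (c ++ z ++ d) ++ b ≡ (a ++ c) ++ z ++ (d ++ b)
++-reassoc a c z d b = begin
  a ++ (c ++ z ++ d) ++ b    ≡⟨ cong (a ++_) (++-assoc c (z ++ d) b) ⟩
  a ++ c ++ (z ++ d) ++ b    ≡⟨ cong (λ t → a ++ c ++ t) (++-assoc z d b) ⟩
  a ++ c ++ z ++ d ++ b      ≡⟨ ++-assoc a c _ ⟨
  (a ++ c) ++ z ++ (d ++ b)  ∎
  where open ≡-Reasoning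

infix-refl : (w : List A) → Infix w w
infix-refl w = [] , [] , sym (++-identityʳ w)

infix-trans : {z w v : List A} → Infix z w → Infix w v → Infix z v
infix-trans {z = z} (c , d , refl) (a , b , refl) = a ++ c , d ++ b , ++-reassoc a c z d b

infix-++ˡ : (α β : List A) → Infix α (α ++ β)
infix-++ˡ α β = [] , β , refl

infix-++ʳ : (α β : List A) → Infix β (α ++ β)
infix-++ʳ α β = α , [] , cong (α ++_) (sym (++-identityʳ β))

++-split : (a c : List A) {b d : List A} → a ++ b ≡ c ++ d →
           (∃[ t ] (c ≡ a ++ t) × (b ≡ t ++ d)) ⊎ (∃[ t ] (a ≡ c ++ t) × (d ≡ t ++ b))
++-split []      c       eq = inj₁ (c , refl , eq)
++-split (_ ∷ a) []      eq = inj₂ (_ , refl , sym eq)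
++-split (_ ∷ a) (_ ∷ c) eq with refl ← ∷-injectiveˡ eq | ++-split a c (∷-injectiveʳ eq)
... | inj₁ (t , p , q) = inj₁ (t , cong (_ ∷_) p , q)
... | inj₂ (t , p , q) = inj₂ (t , cong (_ ∷_) p , q)

prefix-comparable : (a c : List A) {b d : List A} → a ++ b ≡ c ++ d → length a ≤ length c →
                    ∃[ t ] c ≡ a ++ t
prefix-comparable []      c       _  _       = c , refl
prefix-comparable (_ ∷ a) (_ ∷ c) eq (s≤s l)
  with refl ← ∷-injectiveˡ eq | t , p ← prefix-comparable a c (∷-injectiveʳ eq) l = t , cong (_ ∷_) p

suffix-comparable : (a c : List A) {b d : List A} → a ++ b ≡ c ++ d → length b ≤ length d →
                    ∃[ t ] d ≡ t ++ b
suffix-comparable a c {b} {d} eq l with ++-split a c eq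
... | inj₂ (t , _ , q) = t , q
... | inj₁ (t , _ , refl) with t | l
...   | []    | _ = [] , refl
...   | _ ∷ t | l = contradiction (≤-trans l (≤-trans (m≤n+m _ _) (≤-reflexive (sym (length-++ t))))) 1+n≰n

-- Positions count from 0, so this occurrence of `z` fills the half-open interval from `length a` to
-- `length a + length z`.
Hits : ℕ → List A → List A → Set
Hits n w z = ∃[ a ] ∃[ b ] (w ≡ a ++ z ++ b) × (length a ≤ n) × (n < length a + length z)

hits-infix : {w v z : List A} {n : ℕ} (o : Infix w v) → Hits n w z → Hits (length (proj₁ o) + n) v z
hits-infix {z = z} {n} (a , b , refl) (c , d , refl , l , r) =
  a ++ c , d ++ b , ++-reassoc a c z d b ,
  ≤-trans (≤-reflexive (length-++ a)) (+-monoʳ-≤ (length a) l) ,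
  <-≤-trans (+-monoʳ-< (length a) r)
    (≤-reflexive (trans (sym (+-assoc (length a) (length c) _)) (cong (_+ length z) (sym (length-++ a)))))

infix-cut : (α β : List A) {z : List A} → Infix z (α ++ β) →
            Infix z α ⊎ Hits (length α) (α ++ β) z ⊎ Infix z β
infix-cut α β {z} (a , b , eq) with ++-split α a eq
... | inj₁ (t , _ , q) = inj₂ (inj₂ (t , b , q))
... | inj₂ (t , refl , q) with ++-split z t q
...   | inj₁ (t′ , refl , _) = inj₁ (a , t′ , refl)
-- `z` ends exactly at the cut. The position `length α` belongs to `β`, so this is an infix of `α`
-- and not a hit.
...   | inj₂ ([] , refl , _) = inj₁ (a , [] , cong (a ++_) (sym (trans (++-identityʳ _) (++-identityʳ t))))
...   | inj₂ (x ∷ t′ , refl , q′) = inj₂ (inj₁ (a , b , eq ,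
        ≤-trans (m≤m+n _ _) (≤-reflexive (sym (length-++ a))) ,
        <-≤-trans (≤-reflexive (cong suc (length-++ a)))
          (≤-trans (≤-reflexive (sym (+-suc (length a) (length t))))
            (+-monoʳ-≤ (length a) (≤-trans (m<m+n (length t) (s≤s z≤n)) (≤-reflexive (sym (length-++ t))))))))

-- Powers and their periodic infixes

pow : List A → ℕ → List A
pow u n = concat (replicate n u)

pow-snoc : (u : List A) (n : ℕ) → pow u n ++ u ≡ u ++ pow u n
pow-snoc u zero    = sym (++-identityʳ u)
pow-snoc u (suc n) = trans (++-assoc u (pow u n) u) (cong (u ++_) (pow-snoc u n))

pow-+ : (u : List A) (m n : ℕ) → pow u (m + n) ≡ pow u m ++ pow u n
pow-+ u zero    n = refl
pow-+ u (suc m) n = trans (cong (u ++_) (pow-+ u m n)) (sym (++-assoc u (pow u m) (pow u n)))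

-- `q` has period `u`: both `q` and `u ++ q` are prefixes of `pow u (suc n)`, so the longer extends
-- the shorter.
prefix-pow-shift : (u : List A) (n : ℕ) (q : List A) {r : List A} → pow u n ≡ q ++ r → ∃[ t ] u ++ q ≡ q ++ t
prefix-pow-shift u n q {r} eq =
  prefix-comparable q (u ++ q) shifted (≤-trans (m≤n+m _ _) (≤-reflexive (sym (length-++ u))))
  where
  open ≡-Reasoning
  shifted : q ++ r ++ u ≡ (u ++ q) ++ r
  shifted = begin
    q ++ r ++ u    ≡⟨ ++-assoc q r u ⟨
    (q ++ r) ++ u  ≡⟨ cong (_++ u) eq ⟨
    pow u n ++ u   ≡⟨ pow-snoc u n ⟩
    u ++ pow u n   ≡⟨ cong (u ++_) eq ⟩
    u ++ q ++ r    ≡⟨ ++-assoc u q r ⟨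
    (u ++ q) ++ r  ∎

suffix-pow-shift : (u : List A) (n : ℕ) (q : List A) {r : List A} → pow u n ≡ r ++ q → ∃[ t ] q ++ u ≡ t ++ q
suffix-pow-shift u n q {r} eq =
  suffix-comparable (u ++ r) r shifted (≤-trans (m≤m+n _ _) (≤-reflexive (sym (length-++ q))))
  where
  open ≡-Reasoning
  shifted : (u ++ r) ++ q ≡ r ++ q ++ u
  shifted = begin
    (u ++ r) ++ q  ≡⟨ ++-assoc u r q ⟩
    u ++ r ++ q    ≡⟨ cong (u ++_) eq ⟨
    u ++ pow u n   ≡⟨ pow-snoc u n ⟨
    pow u n ++ u   ≡⟨ cong (_++ u) eq ⟩
    (r ++ q) ++ u  ≡⟨ ++-assoc r q u ⟩
    r ++ q ++ u    ∎

-- An infix of a power either lies in one period or can be shifted by whole periods until it meets the outermost cut.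
prefix-pow-cut : (u : List A) (n : ℕ) (q : List A) {r z : List A} → pow u n ≡ q ++ r → Infix z q →
                 Infix z u ⊎ Hits (length u) q z
prefix-pow-cut u zero    []      eq (a , b , e)
  with refl ← ++-conicalˡ a _ (sym e) | refl ← ++-conicalˡ _ b (++-conicalʳ a _ (sym e)) = inj₁ ([] , u , refl)
prefix-pow-cut u (suc n) q {z = z} eq i with ++-split u q eq
... | inj₂ (t , refl , _) = inj₁ (infix-trans i (infix-++ˡ q t))
... | inj₁ (q′ , refl , eq′) with infix-cut u q′ i
...   | inj₁ h        = inj₁ h
...   | inj₂ (inj₁ h) = inj₂ h
...   | inj₂ (inj₂ j) with prefix-pow-cut u n q′ eq′ j
...     | inj₁ h = inj₁ h
-- The hit in `q′` moves to the copy of `q′` at the front of `u ++ q′`, one period to the left, so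
-- its offset stays `length u`.
...     | inj₂ h with t , e ← prefix-pow-shift u n q′ eq′ =
            inj₂ (subst (λ w → Hits (length u) w z) (sym e) (hits-infix (infix-++ˡ q′ t) h))

-- Mirror image of `prefix-pow-cut`: the outermost cut is the one before the last copy of `u`, and
-- its offset depends on the length of `q`.
suffix-pow-cut : (u : List A) (n : ℕ) (q : List A) {r z : List A} → pow u n ≡ r ++ q → Infix z q →
                 Infix z u ⊎ (∃[ p ] (q ≡ p ++ u) × Hits (length p) q z)
suffix-pow-cut u zero    q {r} eq (a , b , refl)
  with e ← ++-conicalʳ r _ (sym eq)
  with refl ← ++-conicalˡ a _ e | refl ← ++-conicalˡ _ b (++-conicalʳ a _ e) = inj₁ ([] , u , refl)
suffix-pow-cut u (suc n) q {r} {z} eq i with ++-split r (pow u n) (trans (sym eq) (sym (pow-snoc u n)))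
... | inj₂ (t , _ , refl) = inj₁ (infix-trans i (infix-++ʳ t q))
... | inj₁ (q′ , eq′ , refl) with infix-cut q′ u i
...   | inj₂ (inj₁ h) = inj₂ (q′ , refl , h)
...   | inj₂ (inj₂ h) = inj₁ h
...   | inj₁ j with suffix-pow-cut u n q′ eq′ j
...     | inj₁ h = inj₁ h
...     | inj₂ (p , q′≡ , h) with t , e ← suffix-pow-shift u n q′ eq′ =
            inj₂ (q′ , refl , subst (λ w → Hits (length q′) w z) (sym e)
                                (subst (λ k → Hits k (t ++ q′) z) shifted (hits-infix (infix-++ʳ t q′) h)))
  where
  open ≡-Reasoning
  shifted : length t + length p ≡ length q′
  shifted = begin
    length t + length p ≡⟨ +-comm (length t) _ ⟩
    length p + length t ≡⟨ cong (length p +_) (+-cancelʳ-≡ (length q′) (length t) (length u) (begin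
        length t + length q′ ≡⟨ length-++ t ⟨
        length (t ++ q′)     ≡⟨ cong length e ⟨
        length (q′ ++ u)     ≡⟨ length-++ q′ ⟩
        length q′ + length u ≡⟨ +-comm (length q′) _ ⟩
        length u + length q′ ∎)) ⟩
    length p + length u ≡⟨ length-++ p ⟨
    length (p ++ u)     ≡⟨ cong length q′≡ ⟨
    length q′           ∎

-- Sums over lists and antichains

+-swapˡ : ∀ a b c → a + (b + c) ≡ b + (a + c)
+-swapˡ = solve-∀

module _ {I : Set} where

  total : (I → ℕ) → List I → ℕ
  total f = sum ∘ map f

  total-+ : (f g : I → ℕ) (xs : List I) → total (λ x → f x + g x) xs ≡ total f xs + total g xs
  total-+ f g []       = refl
  total-+ f g (x ∷ xs) = trans (cong (f x + g x +_) (total-+ f g xs)) (interchange (f x) (g x) _ _)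
    where
    interchange : ∀ a b c d → a + b + (c + d) ≡ a + c + (b + d)
    interchange = solve-∀

  total-++ : (f : I → ℕ) (xs ys : List I) → total f (xs ++ ys) ≡ total f xs + total f ys
  total-++ f xs ys = trans (cong sum (map-++ f xs ys)) (sum-++ (map f xs) (map f ys))

  total-sublist : (f : I → ℕ) {xs ys : List I} → Sublist xs ys → total f xs ≤ total f ys
  total-sublist f []         = z≤n
  total-sublist f (y ∷ʳ s)   = ≤-trans (total-sublist f s) (m≤n+m _ _)
  total-sublist f (refl ∷ s) = +-monoʳ-≤ _ (total-sublist f s)

  -- At most one entry has `e x = 0`. If there is one, `d` is 0 and every other entry pays for
  -- itself; if there is none, all do, and the spare 1 absorbs `d`.
  length+min≤1+total : (e : I → ℕ) {d : ℕ} (xs : List I) → AllPairs (λ x y → 1 ≤ e x + e y) xs →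
                       d ≤ 1 → All (λ x → d ≤ e x) xs → length xs + d ≤ 1 + total e xs
  length+min≤1+total e []       []       d≤1 []       = d≤1
  length+min≤1+total e {d} (x ∷ xs) (p ∷ ps) d≤1 (q ∷ qs) with e x | p | q
  ... | zero  | p | z≤n = s≤s (≤-trans (≤-reflexive (+-identityʳ _)) (positive xs p))
    where
    positive : ∀ xs → All (λ x → 1 ≤ e x) xs → length xs ≤ total e xs
    positive []       []       = z≤n
    positive (x ∷ xs) (p ∷ ps) = +-mono-≤ p (positive xs ps)
  ... | suc k | p | q   =
    s≤s (≤-trans (length+min≤1+total e xs ps d≤1 qs) (s≤s (m≤n+m _ k)))

  module _ (a b : I → ℕ) where

    -- In the application `a` and `b` are the lengths of the two remainders, so the smaller pair
    -- belongs to the longer word.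
    Dominates : I → I → Set
    Dominates g f = a g ≤ a f × b g ≤ b f

    dominates? : ∀ g f → Dec (Dominates g f)
    dominates? g f = a g ≤? a f ×-dec b g ≤? b f

    Incomparable : I → I → Set
    Incomparable f g = ¬ Dominates f g × ¬ Dominates g f

    -- Greedy insertion: a dominated `f` is dropped, any other `f` expels the entries it dominates,
    -- and what those represented passes to `f` by transitivity.
    antichain : (fs : List I) → ∃[ gs ] Sublist gs fs × AllPairs Incomparable gs ×
                All (λ f → Any (λ g → Dominates g f) gs) fs
    antichain [] = [] , [] , [] , []
    antichain (f ∷ fs) with antichain fs
    ... | gs , gs⊆fs , inc , dom with any? (λ g → dominates? g f) gs
    ...   | yes df = gs , f ∷ʳ gs⊆fs , inc , df ∷ dom
    ...   | no ¬df =
            f ∷ filter keep? gs ,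
            refl ∷ ⊆-trans (filter-⊆ keep? gs) gs⊆fs ,
            All.zip (all-filter keep? gs , All.filter⁺ keep? (¬Any⇒All¬ gs ¬df)) ∷ AllPairs.filter⁺ keep? inc ,
            here (≤-refl , ≤-refl) ∷ All.map replace dom
      where
      keep? = ¬? ∘ dominates? f
      replace : ∀ {h} → Any (λ g → Dominates g h) gs → Any (λ g → Dominates g h) (f ∷ filter keep? gs)
      replace {h} any with find any
      ... | g , g∈ , (p , q) with dominates? f g
      ...   | yes (p′ , q′) = here (≤-trans p′ p , ≤-trans q′ q)
      ...   | no ¬d = there (lose (∈-filter⁺ keep? g∈ ¬d) (p , q))

-- Nonempty remainders and coverage by marks

end : List A → ℕ
end []      = 0
end (_ ∷ _) = 1

end≤1 : (x : List A) → end x ≤ 1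
end≤1 []      = z≤n
end≤1 (_ ∷ _) = ≤-refl

end-mono : (x y : List A) → length x ≤ length y → end x ≤ end y
end-mono []      y       _ = z≤n
end-mono (_ ∷ x) (_ ∷ y) _ = ≤-refl

end-++ˡ : (x y : List A) → end x ≤ end (x ++ y)
end-++ˡ x y = end-mono x (x ++ y) (≤-trans (m≤m+n _ _) (≤-reflexive (sym (length-++ x))))

end-++ʳ : (x y : List A) → end y ≤ end (x ++ y)
end-++ʳ x y = end-mono y (x ++ y) (≤-trans (m≤n+m _ _) (≤-reflexive (sym (length-++ x))))

end-sum≥1 : (x y : List A) → ¬ (length x ≡ 0 × length y ≡ 0) → 1 ≤ end x + end y
end-sum≥1 []      []      h = contradiction (refl , refl) h
end-sum≥1 []      (_ ∷ _) h = ≤-refl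
end-sum≥1 (_ ∷ _) y       h = s≤s z≤n

module Covering {A : Set} (T : List A) where

  -- Only the word counts, not where it was found: a hit anywhere in `T` will do, so one window can
  -- stand for all those with smaller words. The empty word is left out because its occurrences
  -- contain no position.
  Covered : List ℕ → List A → Set
  Covered Γ w = ∀ z → 0 < length z → Infix z w → Any (λ p → Hits p T z) Γ

  covered-infix : ∀ {Γ w v} → Infix w v → Covered Γ v → Covered Γ w
  covered-infix i c z 0<z j = c z 0<z (infix-trans j i)

  start : ∀ {w} → Infix w T → ℕ
  start = length ∘ proj₁

  hits⇒any : ∀ {Γ w z n} (o : Infix w T) → start o + n ∈ Γ → Hits n w z → Any (λ p → Hits p T z) Γ
  hits⇒any o m h = lose m (hits-infix o h)

  covered-cut : ∀ {Γ} (α β : List A) (o : Infix (α ++ β) T) → start o + length α ∈ Γ →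
                Covered Γ α → Covered Γ β → Covered Γ (α ++ β)
  covered-cut α β o m cα cβ z 0<z i with infix-cut α β i
  ... | inj₁ j        = cα z 0<z j
  ... | inj₂ (inj₁ h) = hits⇒any o m h
  ... | inj₂ (inj₂ j) = cβ z 0<z j

  covered-prefix-pow : ∀ {Γ} (u : List A) (n : ℕ) (q : List A) {r : List A} → pow u n ≡ q ++ r →
                       (o : Infix q T) → start o + length u ∈ Γ → Covered Γ u → Covered Γ q
  covered-prefix-pow u n q eq o m cu z 0<z i with prefix-pow-cut u n q eq i
  ... | inj₁ j = cu z 0<z j
  ... | inj₂ h = hits⇒any o m h

  -- In a run of at least one period the mark sits where the last copy of `u` begins. A shorter `q`
  -- is an infix of `u`, and the truncated difference is then never consulted.
  covered-suffix-pow : ∀ {Γ} (u : List A) (n : ℕ) (q : List A) {r : List A} → pow u n ≡ r ++ q →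
                       (o : Infix q T) → start o + (length q ∸ length u) ∈ Γ → Covered Γ u → Covered Γ q
  covered-suffix-pow u n q eq o m cu z 0<z i with suffix-pow-cut u n q eq i
  ... | inj₁ j = cu z 0<z j
  ... | inj₂ (p , refl , h) = hits⇒any o
          (subst (λ k → start o + k ∈ _) (trans (cong (_∸ length u) (length-++ p)) (m+n∸n≡m (length p) (length u))) m) h

  covered-[] : ∀ {Γ} → Covered Γ []
  covered-[] z 0<z (a , b , e) with refl ← ++-conicalˡ _ b (++-conicalʳ a _ (sym e)) = contradiction 0<z λ ()

  covered-[-] : ∀ {Γ a} (o : Infix [ a ] T) → start o + 0 ∈ Γ → Covered Γ [ a ]
  covered-[-] {Γ} {a} o m = covered-cut [] [ a ] o m covered-[] letter
    where
    letter : Covered Γ [ a ]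
    letter (x ∷ []) 0<z ([] , [] , refl) = hits⇒any o m ([] , [] , refl , z≤n , s≤s z≤n)
    letter (x ∷ []) 0<z (_ ∷ c , b , e) with () ← ++-conicalʳ c _ (sym (∷-injectiveʳ e))
    letter (x ∷ y ∷ z) 0<z ([] , b , ())
    letter (x ∷ y ∷ z) 0<z (_ ∷ c , b , e) with () ← ++-conicalʳ c _ (sym (∷-injectiveʳ e))

  -- Windows, weights and thinning to antichains

  record Window : Set where
    constructor window
    field
      left word right : List A
      -- Only `word` has to occur in `T`; the remainders may have been discarded by a truncation.
      occurrence      : Infix word T

  open Window

  weight : Window → ℕ
  weight f = end (left f) + end (right f)

  Windows : (Window → Set) → Set
  Windows P = List (Σ Window P)

  totalWeight : ∀ {P} → Windows P → ℕ
  totalWeight = total (weight ∘ proj₁)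

  infix 4 _⊩_
  _⊩_ : ∀ {P} → List ℕ → Windows P → Set
  Γ ⊩ fs = All (Covered Γ ∘ word ∘ proj₁) fs

  Frag : List A → Window → Set
  Frag u f = u ≡ left f ++ word f ++ right f

  infix 4 _≽_
  _≽_ : Window → Window → Set
  g ≽ f = weight g ≤ weight f × word g ≡ word f

  classify : ∀ {P Q R : Window → Set} →
             ((f : Σ Window P) → (Σ[ g ∈ Σ Window Q ] proj₁ g ≽ proj₁ f) ⊎ (Σ[ h ∈ Σ Window R ] proj₁ h ≽ proj₁ f)) →
             (fs : Windows P) → Σ[ gs ∈ Windows Q ] Σ[ hs ∈ Windows R ]
               totalWeight gs + totalWeight hs ≤ totalWeight fs × (∀ {Γ} → Γ ⊩ gs → Γ ⊩ hs → Γ ⊩ fs)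
  classify c [] = [] , [] , z≤n , λ _ _ → []
  classify c (f ∷ fs) with c f | classify c fs
  ... | inj₁ (g , w , refl) | gs , hs , b , s =
          g ∷ gs , hs , ≤-trans (≤-reflexive (+-assoc (weight (proj₁ g)) _ _)) (+-mono-≤ w b) ,
          λ { (p ∷ ps) qs → p ∷ s ps qs }
  ... | inj₂ (h , w , refl) | gs , hs , b , s =
          gs , h ∷ hs , ≤-trans (≤-reflexive (+-swapˡ (totalWeight gs) (weight (proj₁ h)) _)) (+-mono-≤ w b) ,
          λ { ps (q ∷ qs) → q ∷ s ps qs }

  dominated-infix : ∀ {X} (f g : Window) → Frag X f → Frag X g →
                    length (left g) ≤ length (left f) → length (right g) ≤ length (right f) →
                    Infix (word f) (word g)
  dominated-infix f g refl eq l r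
    with t , refl ← prefix-comparable (left g) (left f) (sym eq) l
    with eq′ ← ++-cancelˡ (left g) (t ++ word f ++ right f) (word g ++ right g) (trans (sym (++-assoc (left g) t _)) eq)
    with s , e ← suffix-comparable (word g) (t ++ word f) (trans (sym eq′) (sym (++-assoc t _ _))) r
    = t , s , ++-cancelʳ (right g) (word g) (t ++ word f ++ s) (trans (sym eq′) (trans (cong (λ k → t ++ word f ++ k) e)
        (sym (trans (++-assoc t (word f ++ s) _) (cong (t ++_) (++-assoc (word f) s _))))))

  leftEnd rightEnd : {P : Window → Set} → Σ Window P → ℕ
  leftEnd f = end (left (proj₁ f))
  rightEnd f = end (right (proj₁ f))

  ℓ r : {P : Window → Set} → Σ Window P → ℕ
  ℓ f = length (left (proj₁ f))
  r f = length (right (proj₁ f))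

  -- Here `d` is a common lower bound of the end indicators: 0 where only the number of windows must
  -- be paid, the smallest indicator where the weight of a new window must be paid too.
  record Thinned {P} (fs : Windows P) : Set where
    field
      kept    : Windows P
      lighter : totalWeight kept ≤ totalWeight fs
      sound   : ∀ {Γ} → Γ ⊩ kept → Γ ⊩ fs
      leftBound  : ∀ {d} → d ≤ 1 → All (λ f → d ≤ leftEnd f) kept →
                   length kept + d ≤ 1 + total leftEnd kept
      rightBound : ∀ {d} → d ≤ 1 → All (λ f → d ≤ rightEnd f) kept →
                   length kept + d ≤ 1 + total rightEnd kept

  -- Of two windows of `X` with empty left remainders, comparing the right remainders makes one
  -- dominate the other; likewise with the sides exchanged. So incomparable windows meet the
  -- hypothesis of `length+min≤1+total` on either side.
  thin : ∀ {P X} → (∀ {f} → P f → Frag X f) → (fs : Windows P) → Thinned fs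
  thin {P} {X} frag fs with gs , gs⊆fs , inc , dom ← antichain ℓ r fs = record
    { kept       = gs
    ; lighter    = total-sublist _ gs⊆fs
    ; sound      = λ c → All.map (λ {f} → dominated f c) dom
    ; leftBound  = length+min≤1+total _ gs (AllPairs.map (λ {f} {g} → left-ends f g) inc)
    ; rightBound = length+min≤1+total _ gs (AllPairs.map (λ {f} {g} → right-ends f g) inc)
    }
    where
    dominated : ∀ {Γ gs} f → Γ ⊩ gs → Any (λ g → Dominates ℓ r g f) gs → Covered Γ (word (proj₁ f))
    dominated (f , pf) c any with find any
    ... | (g , pg) , g∈ , p , q = covered-infix (dominated-infix f g (frag pf) (frag pg) p q) (All.lookup c g∈)
    left-ends : ∀ f g → Incomparable ℓ r f g → 1 ≤ leftEnd f + leftEnd g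
    left-ends f g (¬fg , ¬gf) = end-sum≥1 (left (proj₁ f)) (left (proj₁ g)) λ (p , q) →
      [ (λ h → ¬fg (≤-reflexive (trans p (sym q)) , h)) , (λ h → ¬gf (≤-reflexive (trans q (sym p)) , h)) ]′
      (≤-total (length (right (proj₁ f))) (length (right (proj₁ g))))
    right-ends : ∀ f g → Incomparable ℓ r f g → 1 ≤ rightEnd f + rightEnd g
    right-ends f g (¬fg , ¬gf) = end-sum≥1 (right (proj₁ f)) (right (proj₁ g)) λ (p , q) →
      [ (λ h → ¬fg (h , ≤-reflexive (trans p (sym q)))) , (λ h → ¬gf (h , ≤-reflexive (trans q (sym p)))) ]′
      (≤-total (length (left (proj₁ f))) (length (left (proj₁ g))))

  -- Reductions and their cost

  Part : List (List A) → Window → Set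
  Part L f = Any (λ u → Frag u f) L

  -- `sound` admits every larger `Γ`, since marks made later for `rest` are added to `marks`.
  record Reduction {P} (L : List (List A)) (fs : Windows P) : Set where
    field
      marks : List ℕ
      rest  : Windows (Part L)
      bound : 2 * length marks + totalWeight rest ≤ 2 + totalWeight fs
      sound : ∀ {Γ} → marks ⊆ Γ → Γ ⊩ rest → Γ ⊩ fs

  empty : ∀ {P L} → Reduction {P} L []
  empty = record { marks = [] ; rest = [] ; bound = z≤n ; sound = λ _ _ → [] }

  weaken : ∀ {P Q L} {fs : Windows P} {hs : Windows Q} → Reduction L hs →
           totalWeight hs ≤ totalWeight fs → (∀ {Γ} → Γ ⊩ hs → Γ ⊩ fs) → Reduction L fs
  weaken R b s = record
    { marks = R.marks ; rest = R.rest ; bound = ≤-trans R.bound (+-monoʳ-≤ 2 b) ; sound = λ m c → s (R.sound m c) }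
    where module R = Reduction R

  passDown : ∀ {P Q L} {fs : Windows P} (gs : Windows (Part L)) {hs : Windows Q} → Reduction L hs →
             totalWeight gs + totalWeight hs ≤ totalWeight fs →
             (∀ {Γ} → Γ ⊩ gs → Γ ⊩ hs → Γ ⊩ fs) → Reduction L fs
  passDown {fs = fs} gs {hs} R b s = record
    { marks = R.marks
    ; rest  = gs ++ R.rest
    ; bound = begin
        2 * length R.marks + totalWeight (gs ++ R.rest)             ≡⟨ cong (2 * length R.marks +_) (total-++ _ gs R.rest) ⟩
        2 * length R.marks + (totalWeight gs + totalWeight R.rest)  ≡⟨ +-swapˡ (2 * length R.marks) (totalWeight gs) (totalWeight R.rest) ⟩
        totalWeight gs + (2 * length R.marks + totalWeight R.rest)  ≤⟨ +-monoʳ-≤ (totalWeight gs) R.bound ⟩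
        totalWeight gs + (2 + totalWeight hs)                       ≡⟨ +-swapˡ (totalWeight gs) 2 (totalWeight hs) ⟩
        2 + (totalWeight gs + totalWeight hs)                       ≤⟨ +-monoʳ-≤ 2 b ⟩
        2 + totalWeight fs                                          ∎
    ; sound = λ m c → s (All.++⁻ˡ gs c) (R.sound m (All.++⁻ʳ gs c))
    }
    where
    module R = Reduction R
    open ≤-Reasoning

  -- Concatenation rules

  Cross : List A → List A → Window → Set
  Cross u v f = ∃[ α ] ∃[ β ] (word f ≡ α ++ β) × (u ≡ left f ++ α) × (v ≡ β ++ right f)

  cross⇒frag : ∀ {u v f} → Cross u v f → Frag (u ++ v) f
  cross⇒frag {f = window x _ y _} (α , β , refl , refl , refl) =
    trans (++-assoc x α _) (cong (x ++_) (sym (++-assoc α β y)))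

  module _ {L : List (List A)} {u v : List A} (u∈L : u ∈ L) (v∈L : v ∈ L) where

    cut : Σ Window (Cross u v) → ℕ
    cut (f , α , _) = start (occurrence f) + length α

    suffixPart prefixPart : Σ Window (Cross u v) → Σ Window (Part L)
    suffixPart (f , α , β , ew , eu , _) =
      window (left f) α [] (infix-trans (subst (Infix α) (sym ew) (infix-++ˡ α β)) (occurrence f)) ,
      lose u∈L (trans eu (cong (left f ++_) (sym (++-identityʳ α))))
    prefixPart (f , α , β , ew , _ , ev) =
      window [] β (right f) (infix-trans (subst (Infix β) (sym ew) (infix-++ʳ α β)) (occurrence f)) ,
      lose v∈L ev

    -- A shorter left remainder gives `g` a suffix of `u` that contains the one in `f`, and `h` does
    -- the same on the right. Only the cut needs a mark in `f` itself.
    covered-cross : ∀ {Γ} (f g h : Σ Window (Cross u v)) → cut f ∈ Γ → ℓ g ≤ ℓ f → r h ≤ r f →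
                    Covered Γ (word (proj₁ (suffixPart g))) → Covered Γ (word (proj₁ (prefixPart h))) →
                    Covered Γ (word (proj₁ f))
    covered-cross (window x _ y o , α , β , refl , eu , ev) (window x′ _ _ _ , α′ , _ , refl , eu′ , _)
                  (window _ _ y′ _ , _ , β′ , refl , _ , ev′) m l r cα cβ
      with t , refl ← prefix-comparable x′ x (trans (sym eu′) eu) l
      with s , refl ← suffix-comparable β′ β (trans (sym ev′) ev) r
      with refl ← ++-cancelˡ x′ α′ (t ++ α) (trans (sym eu′) (trans eu (++-assoc x′ t α)))
      with refl ← ++-cancelʳ y′ β′ (β ++ s) (trans (sym ev′) (trans ev (sym (++-assoc β s y′))))
      = covered-cut α β o m (covered-infix (infix-++ʳ t α) cα) (covered-infix (infix-++ˡ β s) cβ)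

    reduce-cross : (fs : Windows (Cross u v)) → Reduction L fs
    reduce-cross fs with thin (λ {f} → cross⇒frag {f = f}) fs
    ... | record { kept = [] ; lighter = w ; sound = s } = weaken empty w s
    ... | record { kept = k ∷ ks ; lighter = w ; sound = s ; leftBound = lb ; rightBound = rb } = weaken (record
            { marks = map cut (k ∷ ks)
            ; rest  = suffixPart g ∷ prefixPart h ∷ []
            ; bound = begin
                2 * length (map cut (k ∷ ks)) + (leftEnd g + 0 + (rightEnd h + 0))
                  ≡⟨ cong (λ n → 2 * n + (leftEnd g + 0 + (rightEnd h + 0))) (length-map cut (k ∷ ks)) ⟩
                2 * length (k ∷ ks) + (leftEnd g + 0 + (rightEnd h + 0))
                  ≡⟨ arrange (length (k ∷ ks)) (leftEnd g) (rightEnd h) ⟩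
                (length (k ∷ ks) + leftEnd g) + (length (k ∷ ks) + rightEnd h)
                  -- Of the two units per mark, one is charged to the left ends and one to the right
                  -- ends. As `g` and `h` have the shortest remainders, their indicators are lower
                  -- bounds, so each side also pays for its new window.
                  ≤⟨ +-mono-≤ (lb (end≤1 (left (proj₁ g))) (All.map (λ {f} → end-mono (left (proj₁ g)) (left (proj₁ f))) gmin))
                              (rb (end≤1 (right (proj₁ h))) (All.map (λ {f} → end-mono (right (proj₁ h)) (right (proj₁ f))) hmin)) ⟩
                1 + total leftEnd (k ∷ ks) + (1 + total rightEnd (k ∷ ks))
                  ≡⟨ cong suc (+-suc _ _) ⟩
                2 + (total leftEnd (k ∷ ks) + total rightEnd (k ∷ ks))
                  ≡⟨ cong (2 +_) (total-+ leftEnd rightEnd (k ∷ ks)) ⟨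
                2 + totalWeight (k ∷ ks) ∎
            ; sound = λ { m (cg ∷ ch ∷ []) → All.tabulate λ {f} f∈ →
                covered-cross f g h (m (∈-map⁺ cut f∈)) (All.lookup gmin f∈) (All.lookup hmin f∈) cg ch }
            }) w s
      where
      open ≤-Reasoning
      g = argmin ℓ k ks
      h = argmin r k ks
      gmin : All (λ f → ℓ g ≤ ℓ f) (k ∷ ks)
      gmin = f[argmin]≤f[⊤] {f = ℓ} k ks ∷ f[argmin]≤f[xs] {f = ℓ} k ks
      hmin : All (λ f → r h ≤ r f) (k ∷ ks)
      hmin = f[argmin]≤f[⊤] {f = r} k ks ∷ f[argmin]≤f[xs] {f = r} k ks
      arrange : ∀ n a b → 2 * n + (a + 0 + (b + 0)) ≡ (n + a) + (n + b)
      arrange = solve-∀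

    classify-pair : (f : Σ Window (Frag (u ++ v))) →
                    (Σ[ g ∈ Σ Window (Part L) ] proj₁ g ≽ proj₁ f) ⊎ (Σ[ h ∈ Σ Window (Cross u v) ] proj₁ h ≽ proj₁ f)
    classify-pair (window x w y o , eq) with ++-split u x eq
    ... | inj₁ (t , refl , ev) =
            inj₁ ((window t w y o , lose v∈L ev) , +-monoˡ-≤ _ (end-++ʳ u t) , refl)
    ... | inj₂ (t , eu , eq′) with ++-split t w (sym eq′)
    ...   | inj₁ (β , ew , ev) = inj₂ ((window x w y o , t , β , ew , eu , ev) , ≤-refl , refl)
    ...   | inj₂ (s , refl , refl) =
            inj₁ ((window x w s o , lose u∈L eu) , +-monoʳ-≤ (end x) (end-++ˡ s v) , refl)

    reduce-pair : (fs : Windows (Frag (u ++ v))) → Reduction L fs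
    reduce-pair fs with gs , hs , b , s ← classify classify-pair fs = passDown gs (reduce-cross hs) b s

  -- Terminal and truncation rules

  reduce-term : ∀ {L a} (fs : Windows (Frag [ a ])) → Reduction L fs
  reduce-term [] = empty
  reduce-term (f@(window x [] y o , _) ∷ fs) =
    weaken (reduce-term fs) (m≤n+m _ (weight (proj₁ f))) λ c → covered-[] ∷ c
  reduce-term (f@(window (_ ∷ x) (b ∷ w) y o , eq) ∷ fs) with () ← ++-conicalʳ x _ (sym (∷-injectiveʳ eq))
  -- The word of this window is all of `[ a ]`, which contains every other word of the list, so one
  -- mark serves them all.
  reduce-term {a = a} fs@((window [] (b ∷ w) y o , eq) ∷ _)
    with refl ← ∷-injectiveˡ eq | refl ← ++-conicalˡ w y (sym (∷-injectiveʳ eq)) = record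
    { marks = [ start o + 0 ]
    ; rest  = []
    ; bound = m≤m+n 2 _
    ; sound = λ m _ → All.universal
        (λ (f , e) → covered-infix (left f , right f , e) (covered-[-] o (m (here refl)))) fs
    }

  -- Extending the remainders by `x` and `y` may raise every weight to 2, but an antichain of k
  -- windows already weighs at least 2k - 2, and the two units of the rule supply the rest. No mark
  -- is made.
  reduce-trunc : ∀ {L x w y} → (x ++ w ++ y) ∈ L → (fs : Windows (Frag w)) → Reduction L fs
  reduce-trunc {L} {x} {w} {y} k∈L fs = weaken (record
    { marks = []
    ; rest  = map extend kept
    ; bound = begin
        totalWeight (map extend kept)   ≤⟨ atMost2 (map extend kept) ⟩
        2 * length (map extend kept)    ≡⟨ cong (2 *_) (length-map extend kept) ⟩
        2 * length kept                 ≡⟨ double (length kept) ⟩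
        (length kept + 0) + (length kept + 0)
          ≤⟨ +-mono-≤ (leftBound z≤n (All.universal (λ _ → z≤n) kept)) (rightBound z≤n (All.universal (λ _ → z≤n) kept)) ⟩
        1 + total leftEnd kept + (1 + total rightEnd kept)
          ≡⟨ cong suc (+-suc _ _) ⟩
        2 + (total leftEnd kept + total rightEnd kept)
          ≡⟨ cong (2 +_) (total-+ leftEnd rightEnd kept) ⟨
        2 + totalWeight kept            ∎
    ; sound = λ _ → All.map⁻
    }) lighter sound
    where
    open ≤-Reasoning
    open Thinned (thin id fs)
    extend : Σ Window (Frag w) → Σ Window (Part L)
    extend (f , e) = window (x ++ left f) (word f) (right f ++ y) (occurrence f) ,
      lose k∈L (trans (cong (λ v → x ++ v ++ y) e) (++-reassoc x (left f) (word f) (right f) y))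
    atMost2 : ∀ {P} (gs : Windows P) → totalWeight gs ≤ 2 * length gs
    atMost2 []       = z≤n
    atMost2 (g ∷ gs) = ≤-trans (+-mono-≤ (+-mono-≤ (end≤1 (left (proj₁ g))) (end≤1 (right (proj₁ g)))) (atMost2 gs))
                               (≤-reflexive (sym (*-suc 2 (length gs))))
    double : ∀ n → 2 * n ≡ (n + 0) + (n + 0)
    double = solve-∀

  -- Repetition rules

  PowCross : List A → Window → Set
  PowCross u f = ∃[ s ] ∃[ m ] ∃[ p ] (word f ≡ s ++ pow u m ++ p) × (u ≡ left f ++ s) × (u ≡ p ++ right f)

  pow-prefix : (u : List A) (m : ℕ) {p y : List A} → u ≡ p ++ y → pow u (suc m) ≡ (pow u m ++ p) ++ y
  pow-prefix u m {p} {y} eq = begin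
    u ++ pow u m         ≡⟨ pow-snoc u m ⟨
    pow u m ++ u         ≡⟨ cong (pow u m ++_) eq ⟩
    pow u m ++ p ++ y    ≡⟨ ++-assoc (pow u m) p y ⟨
    (pow u m ++ p) ++ y  ∎
    where open ≡-Reasoning

  pow-suffix : (u : List A) (m : ℕ) (x s : List A) → u ≡ x ++ s → pow u (suc m) ≡ x ++ s ++ pow u m
  pow-suffix u m x s eq = trans (cong (_++ pow u m) eq) (++-assoc x s (pow u m))

  -- Puts prefixes of powers with different exponents into the common power `pow u (n + n′)`, where
  -- they are comparable by length.
  pow-common-prefix : (u : List A) (n n′ : ℕ) (q y q′ y′ : List A) → pow u n ≡ q ++ y → pow u n′ ≡ q′ ++ y′ →
                      q ++ y ++ pow u n′ ≡ q′ ++ y′ ++ pow u n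
  pow-common-prefix u n n′ q y q′ y′ e e′ = begin
    q ++ y ++ pow u n′      ≡⟨ ++-assoc q y _ ⟨
    (q ++ y) ++ pow u n′    ≡⟨ cong (_++ pow u n′) e ⟨
    pow u n ++ pow u n′     ≡⟨ pow-+ u n n′ ⟨
    pow u (n + n′)          ≡⟨ cong (pow u) (+-comm n n′) ⟩
    pow u (n′ + n)          ≡⟨ pow-+ u n′ n ⟩
    pow u n′ ++ pow u n     ≡⟨ cong (_++ pow u n) e′ ⟩
    (q′ ++ y′) ++ pow u n   ≡⟨ ++-assoc q′ y′ _ ⟩
    q′ ++ y′ ++ pow u n     ∎
    where open ≡-Reasoning

  pow-common-suffix : (u : List A) (n n′ : ℕ) (x q x′ q′ : List A) → pow u n ≡ x ++ q → pow u n′ ≡ x′ ++ q′ →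
                      (pow u n′ ++ x) ++ q ≡ (pow u n ++ x′) ++ q′
  pow-common-suffix u n n′ x q x′ q′ e e′ = begin
    (pow u n′ ++ x) ++ q    ≡⟨ ++-assoc (pow u n′) x q ⟩
    pow u n′ ++ x ++ q      ≡⟨ cong (pow u n′ ++_) e ⟨
    pow u n′ ++ pow u n     ≡⟨ pow-+ u n′ n ⟨
    pow u (n′ + n)          ≡⟨ cong (pow u) (+-comm n′ n) ⟩
    pow u (n + n′)          ≡⟨ pow-+ u n n′ ⟩
    pow u n ++ pow u n′     ≡⟨ cong (pow u n ++_) e′ ⟩
    pow u n ++ x′ ++ q′     ≡⟨ ++-assoc (pow u n) x′ q′ ⟨
    (pow u n ++ x′) ++ q′   ∎
    where open ≡-Reasoning

  -- The bound on `end y′` matters at the end of the power: an empty `y` must leave an empty `y′`,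
  -- so the last copy of `u` is then taken as `p` and no weight is added.
  pow-split : (u : List A) (k : ℕ) (t : List A) {y : List A} → pow u (suc k) ≡ t ++ y →
              ∃[ m ] ∃[ p ] ∃[ y′ ] (t ≡ pow u m ++ p) × (u ≡ p ++ y′) × end y′ ≤ end y
  pow-split u zero    t {y} eq = 0 , t , y , refl , trans (sym (++-identityʳ u)) eq , ≤-refl
  pow-split u (suc k) t eq with ++-split u t eq
  ... | inj₂ (s , eu , refl) = 0 , t , s , refl , eu , end-++ˡ s (pow u (suc k))
  ... | inj₁ (t′ , refl , eq′) with m , p , y′ , refl , eu , b ← pow-split u k t′ eq′ =
          suc m , p , y′ , sym (++-assoc u (pow u m) p) , eu , b

  module _ {L : List (List A)} {u : List A} (u∈L : u ∈ L) where

    classify-pow : (k : ℕ) (f : Σ Window (Frag (pow u (suc k)))) →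
                   (Σ[ g ∈ Σ Window (Part L) ] proj₁ g ≽ proj₁ f) ⊎ (Σ[ h ∈ Σ Window (PowCross u) ] proj₁ h ≽ proj₁ f)
    classify-pow zero (window x w y o , eq) =
      inj₁ ((window x w y o , lose u∈L (trans (sym (++-identityʳ u)) eq)) , ≤-refl , refl)
    classify-pow (suc k) (window x w y o , eq) with ++-split u x eq
    ... | inj₁ (t , refl , eq′) with classify-pow k (window t w y o , eq′)
    ...   | inj₁ (g , b , e) = inj₁ (g , ≤-trans b (+-monoˡ-≤ _ (end-++ʳ u t)) , e)
    ...   | inj₂ (g , b , e) = inj₂ (g , ≤-trans b (+-monoˡ-≤ _ (end-++ʳ u t)) , e)
    classify-pow (suc k) (window x w y o , eq) | inj₂ (t , eu , eq′) with ++-split t w (sym eq′)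
    ...   | inj₂ (s , refl , refl) =
            inj₁ ((window x w s o , lose u∈L eu) , +-monoʳ-≤ (end x) (end-++ˡ s _) , refl)
    ...   | inj₁ (t′ , refl , eq″) with m , p , y′ , refl , eu′ , b ← pow-split u k t′ eq″ =
            inj₂ ((window x w y′ o , t , m , p , refl , eu , eu′) , +-monoʳ-≤ (end x) b , refl)

    -- A window with positive `m` shows an occurrence of `u` in `T`, which can become the remaining
    -- window. If every `m` is 0, the windows are those across the cut of `u ++ u`.
    full-or-cross : (fs : Windows (PowCross u)) →
                    Infix u T ⊎ (Σ[ gs ∈ Windows (Cross u u) ] totalWeight gs ≤ totalWeight fs × (∀ {Γ} → Γ ⊩ gs → Γ ⊩ fs))
    full-or-cross [] = inj₂ ([] , z≤n , λ _ → [])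
    full-or-cross ((f , s , suc m , p , ew , _) ∷ fs) =
      inj₁ (infix-trans (s , pow u m ++ p , trans ew (cong (s ++_) (++-assoc u (pow u m) p))) (occurrence f))
    full-or-cross ((f , s , zero , p , ew , eu , eu′) ∷ fs) with full-or-cross fs
    ... | inj₁ o = inj₁ o
    ... | inj₂ (gs , b , c) =
            inj₂ ((f , s , p , ew , eu , eu′) ∷ gs , +-monoʳ-≤ (weight f) b , λ { (h ∷ hs) → h ∷ c hs })

    record Peeling (Q : Set) (body : Q → List A) (n : ℕ) (w : List A) : Set where
      field
        marks   : List ℕ
        core    : Q
        bound   : length marks ≤ n
        sound   : ∀ {Γ} → marks ⊆ Γ → Covered Γ u → Covered Γ (body core) → Covered Γ w

    -- Cutting off one end of each window leaves runs of the period that are nested, so a mark in the longest serves all.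
    peel-all : {Q : Set} (body : Q → List A) (mark : Q → ℕ)
               (longest : ∀ {Γ} q q′ → length (body q) ≤ length (body q′) → mark q′ ∈ Γ → Covered Γ u → Covered Γ (body q))
               (e : Σ Window (PowCross u) → ℕ) (peel : ∀ f → Peeling Q body (e f) (word (proj₁ f))) →
               (fs : Windows (PowCross u)) →
               ∃[ M ] length M ≤ 1 + total e fs × (∀ {Γ} → M ⊆ Γ → Covered Γ u → Γ ⊩ fs)
    peel-all body mark longest e peel [] = [] , z≤n , λ _ _ → []
    peel-all {Q} body mark longest e peel (f ∷ fs) =
      mark q ∷ marks (f ∷ fs) , s≤s (marks-bound (f ∷ fs)) , λ m cu → All.tabulate λ {g} g∈ →
        Peeling.sound (peel g) (λ p∈ → m (there (marks-⊇ g∈ p∈))) cu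
          (longest (core g) q (All.lookup q-longest g∈) (m (here refl)) cu)
      where
      core : Σ Window (PowCross u) → Q
      core = Peeling.core ∘ peel
      size : Σ Window (PowCross u) → ℕ
      size = length ∘ body ∘ core
      q : Q
      q = core (argmax size f fs)
      q-longest : All (λ g → size g ≤ length (body q)) (f ∷ fs)
      q-longest = f[⊥]≤f[argmax] {f = size} f fs ∷ f[xs]≤f[argmax] {f = size} f fs
      marks : Windows (PowCross u) → List ℕ
      marks []       = []
      marks (g ∷ gs) = Peeling.marks (peel g) ++ marks gs
      marks-bound : ∀ gs → length (marks gs) ≤ total e gs
      marks-bound []       = z≤n
      marks-bound (g ∷ gs) = ≤-trans (≤-reflexive (length-++ (Peeling.marks (peel g))))
                                     (+-mono-≤ (Peeling.bound (peel g)) (marks-bound gs))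
      marks-⊇ : ∀ {g gs} → g ∈ gs → Peeling.marks (peel g) ⊆ marks gs
      marks-⊇ (here refl)      p∈ = ∈-++⁺ˡ p∈
      marks-⊇ {gs = h ∷ _} (there g∈) p∈ = ∈-++⁺ʳ (Peeling.marks (peel h)) (marks-⊇ g∈ p∈)

    PrefixRun SuffixRun : Set
    PrefixRun = Σ[ q ∈ List A ] Infix q T × ∃[ n ] ∃[ y ] pow u n ≡ q ++ y
    SuffixRun = Σ[ q ∈ List A ] Infix q T × ∃[ n ] ∃[ x ] pow u n ≡ x ++ q

    longest-prefix : ∀ {Γ} (q q′ : PrefixRun) → length (proj₁ q) ≤ length (proj₁ q′) →
                     start (proj₁ (proj₂ q′)) + length u ∈ Γ → Covered Γ u → Covered Γ (proj₁ q)
    longest-prefix (q , _ , n , y , e) (q′ , o , n′ , y′ , e′) l m cu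
      with t , refl ← prefix-comparable q q′ (pow-common-prefix u n n′ q y q′ y′ e e′) l
      = covered-infix (infix-++ˡ q t) (covered-prefix-pow u n′ (q ++ t) e′ o m cu)

    longest-suffix : ∀ {Γ} (q q′ : SuffixRun) → length (proj₁ q) ≤ length (proj₁ q′) →
                     start (proj₁ (proj₂ q′)) + (length (proj₁ q′) ∸ length u) ∈ Γ → Covered Γ u → Covered Γ (proj₁ q)
    longest-suffix (q , _ , n , x , e) (q′ , o , n′ , x′ , e′) l m cu
      with t , refl ← suffix-comparable (pow u n′ ++ x) (pow u n ++ x′) (pow-common-suffix u n n′ x q x′ q′ e e′) l
      = covered-infix (infix-++ʳ t q) (covered-suffix-pow u n′ (t ++ q) {r = x′} e′ o m cu)

    -- A nonempty left remainder makes `s` an incomplete copy, cut off with the one mark that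
    -- `leftEnd` pays for. An empty one makes `s` all of `u`, so the word is already a prefix of a
    -- power.
    peel-left : (f : Σ Window (PowCross u)) → Peeling PrefixRun proj₁ (leftEnd f) (word (proj₁ f))
    peel-left (window [] w y o , s , m , p , refl , refl , eu) = record
      { marks = []
      ; core  = w , o , suc (suc m) , y , trans (cong (u ++_) (pow-prefix u m eu)) (sym (++-assoc u (pow u m ++ p) y))
      ; bound = z≤n
      ; sound = λ _ _ c → c
      }
    peel-left (window (_ ∷ x) _ y o , s , m , p , refl , eu′ , eu) = record
      { marks = [ start o + length s ]
      ; core  = pow u m ++ p , infix-trans (infix-++ʳ s _) o , suc m , y , pow-prefix u m eu
      ; bound = ≤-refl
      ; sound = λ m∈ cu c → covered-cut s _ o (m∈ (here refl)) (covered-infix (subst (Infix s) (sym eu′) (infix-++ʳ (_ ∷ x) s)) cu) c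
      }

    peel-right : (f : Σ Window (PowCross u)) → Peeling SuffixRun proj₁ (rightEnd f) (word (proj₁ f))
    peel-right (window x w [] o , s , m , p , refl , eu , eu′) = record
      { marks = []
      ; core  = w , o , suc (suc m) , x , (begin
          pow u (suc (suc m))            ≡⟨ pow-suffix u (suc m) x s eu ⟩
          x ++ s ++ u ++ pow u m         ≡⟨ cong (λ t → x ++ s ++ t) (pow-snoc u m) ⟨
          x ++ s ++ pow u m ++ u         ≡⟨ cong (λ t → x ++ s ++ pow u m ++ t) (trans eu′ (++-identityʳ p)) ⟩
          x ++ s ++ pow u m ++ p         ∎)
      ; bound = z≤n
      ; sound = λ _ _ c → c
      }
      where open ≡-Reasoning
    peel-right (window x _ (_ ∷ y) o , s , m , p , refl , eu , eu′) = record
      { marks = [ start o + length (s ++ pow u m) ]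
      ; core  = s ++ pow u m , infix-trans (infix-++ˡ _ p) (proj₁ o , proj₁ (proj₂ o) , reassoc) , suc m , x , pow-suffix u m x s eu
      ; bound = ≤-refl
      ; sound = λ m∈ cu c → subst (Covered _) (++-assoc s (pow u m) p)
          (covered-cut (s ++ pow u m) p (proj₁ o , proj₁ (proj₂ o) , reassoc) (m∈ (here refl)) c
            (covered-infix (subst (Infix p) (sym eu′) (infix-++ˡ p (_ ∷ y))) cu))
      }
      where
      reassoc : T ≡ proj₁ o ++ ((s ++ pow u m) ++ p) ++ proj₁ (proj₂ o)
      reassoc = trans (proj₂ (proj₂ o)) (cong (λ t → proj₁ o ++ t ++ proj₁ (proj₂ o)) (sym (++-assoc s (pow u m) p)))

    reduce-run : Infix u T → (fs : Windows (PowCross u)) → Reduction L fs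
    reduce-run o fs =
      [ (λ l → reduction (peel-all proj₁ _ longest-prefix _ peel-left fs) (+-monoʳ-≤ lefts l))
      , (λ l → reduction (peel-all proj₁ _ longest-suffix _ peel-right fs) (+-monoˡ-≤ rights l)) ]′
      (≤-total lefts rights)
      where
      open ≤-Reasoning
      lefts  = total leftEnd fs
      rights = total rightEnd fs
      -- `n` is the smaller of the two numbers of ends, so its double is at most the total weight.
      reduction : ∀ {n} → (∃[ M ] length M ≤ 1 + n × (∀ {Γ} → M ⊆ Γ → Covered Γ u → Γ ⊩ fs)) →
                  n + n ≤ lefts + rights → Reduction L fs
      reduction {n} (M , b , s) l = record
        { marks = M
        -- The occurrence of `u` is the whole expansion, so this window has weight 0.
        ; rest  = [ window [] u [] o , lose u∈L (sym (++-identityʳ u)) ]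
        ; bound = begin
            2 * length M + 0        ≤⟨ +-monoˡ-≤ 0 (*-monoʳ-≤ 2 b) ⟩
            2 * (1 + n) + 0         ≡⟨ double n ⟩
            2 + (n + n)             ≤⟨ +-monoʳ-≤ 2 l ⟩
            2 + (lefts + rights)    ≡⟨ cong (2 +_) (total-+ leftEnd rightEnd fs) ⟨
            2 + totalWeight fs      ∎
        ; sound = λ { m (cu ∷ []) → s m cu }
        }
        where
        double : ∀ n → 2 * (1 + n) + 0 ≡ 2 + (n + n)
        double = solve-∀

    reduce-pow : (k : ℕ) (fs : Windows (Frag (pow u (suc k)))) → Reduction L fs
    reduce-pow k fs with gs , hs , b , s ← classify (classify-pow k) fs = passDown gs (reduce-powCross hs) b s
      where
      reduce-powCross : ∀ hs → Reduction L hs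
      reduce-powCross hs with full-or-cross hs
      ... | inj₁ o            = reduce-run o hs
      ... | inj₂ (gs , b , s) = weaken (reduce-cross u∈L u∈L gs) b s

-- Programs of words and the elimination of rules

substr-parts : (u : List A) (i j : ℕ) → ∃[ x ] ∃[ y ] u ≡ x ++ substr u i j ++ y
substr-parts u i j = take (i ∸ 1) u , drop (j ∸ i + 1) (drop (i ∸ 1) u) ,
  sym (trans (cong (take (i ∸ 1) u ++_) (take++drop≡id (j ∸ i + 1) _)) (take++drop≡id (i ∸ 1) u))

data Built (L : List (List A)) : List A → Set where
  term  : ∀ a → Built L [ a ]
  pair  : ∀ {u v} → u ∈ L → v ∈ L → Built L (u ++ v)
  power : ∀ {u} k → u ∈ L → Built L (pow u (suc k))
  trunc : ∀ x {w} y → x ++ w ++ y ∈ L → Built L w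

-- Each word is built from words further down the list, so taking words off the front eliminates the
-- rules from the top.
data Program {A : Set} : List (List A) → Set where
  []  : Program []
  _∷_ : ∀ {L w} → Built L w → Program L → Program (w ∷ L)

module _ {A : Set} (T : List A) where
  open Covering T

  reduce : ∀ {L w} → Built L w → (fs : Windows (Frag w)) → Reduction L fs
  reduce (term a)      fs = reduce-term fs
  reduce (pair p q)    fs = reduce-pair p q fs
  reduce (power k p)   fs = reduce-pow p k fs
  reduce (trunc x y p) fs = reduce-trunc {x = x} {y = y} p fs

  -- The budget is two units per remaining rule plus the current weight. Windows of the front word
  -- are reduced; the others are already windows of the tail and wait.
  cover : ∀ {L} → Program L → (fs : Windows (Part L)) →
          ∃[ Γ ] 2 * length Γ ≤ 2 * length L + totalWeight fs × Γ ⊩ fs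
  cover []               []             = [] , z≤n , []
  cover []               ((_ , ()) ∷ _)
  cover {w ∷ L} (b ∷ P) fs
    with gs , hs , split-bound , split ← classify {Q = Frag w} {R = Part L}
           (λ { (f , here e)  → inj₁ ((f , e) , ≤-refl , refl)
              ; (f , there p) → inj₂ ((f , p) , ≤-refl , refl) }) fs
    with record { marks = M ; rest = rest ; bound = bound ; sound = sound } ← reduce b gs
    with Γ , Γ-bound , cΓ ← cover P (rest ++ hs) =
      M ++ Γ , total-bound , split (sound ∈-++⁺ˡ (All.map extend (All.++⁻ˡ rest cΓ))) (All.map extend (All.++⁻ʳ rest cΓ))
    where
    open ≤-Reasoning
    extend : ∀ {v} → Covered Γ v → Covered (M ++ Γ) v
    extend c z 0<z i = Any-resp-⊆ (∈-++⁺ʳ M) (c z 0<z i)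
    regroup₁ : ∀ m l r h → 2 * m + (2 * l + (r + h)) ≡ 2 * l + ((2 * m + r) + h)
    regroup₁ = solve-∀
    regroup₂ : ∀ l g h → 2 * l + ((2 + g) + h) ≡ 2 * (1 + l) + (g + h)
    regroup₂ = solve-∀
    total-bound : 2 * length (M ++ Γ) ≤ 2 * length (w ∷ L) + totalWeight fs
    total-bound = begin
      2 * length (M ++ Γ)                                       ≡⟨ cong (2 *_) (length-++ M) ⟩
      2 * (length M + length Γ)                                 ≡⟨ *-distribˡ-+ 2 (length M) (length Γ) ⟩
      2 * length M + 2 * length Γ                               ≤⟨ +-monoʳ-≤ (2 * length M) Γ-bound ⟩
      2 * length M + (2 * length L + totalWeight (rest ++ hs))  ≡⟨ cong (λ t → 2 * length M + (2 * length L + t)) (total-++ _ rest hs) ⟩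
      2 * length M + (2 * length L + (totalWeight rest + totalWeight hs))
        ≡⟨ regroup₁ (length M) (length L) (totalWeight rest) (totalWeight hs) ⟩
      2 * length L + ((2 * length M + totalWeight rest) + totalWeight hs)
        ≤⟨ +-monoʳ-≤ (2 * length L) (+-monoˡ-≤ (totalWeight hs) bound) ⟩
      2 * length L + ((2 + totalWeight gs) + totalWeight hs)    ≡⟨ regroup₂ (length L) (totalWeight gs) (totalWeight hs) ⟩
      2 * length (w ∷ L) + (totalWeight gs + totalWeight hs)    ≤⟨ +-monoʳ-≤ (2 * length (w ∷ L)) split-bound ⟩
      2 * length (w ∷ L) + totalWeight fs                       ∎

  cover-whole : ∀ {L} → Program L → T ∈ L → ∃[ Γ ] length Γ ≤ length L × Covered Γ T
  cover-whole {L} P T∈L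
    with Γ , b , c ∷ [] ← cover P [ window [] T [] (infix-refl T) , lose T∈L (sym (++-identityʳ T)) ] =
      Γ , *-cancelˡ-≤ 2 (≤-trans b (≤-reflexive (+-identityʳ _))) , c

  -- From marks to a string attractor

  substr-nonempty : ∀ i j → 1 ≤ i → i ≤ j → j ≤ length T → 0 < length (substr T i j)
  substr-nonempty (suc i) j _ i≤j j≤n =
    subst (0 <_) (sym (length-take (j ∸ suc i + 1) (drop i T)))
      (⊓-glb (m≤n+m 1 (j ∸ suc i)) (subst (0 <_) (sym (length-drop i T)) (m<n⇒0<n∸m (≤-trans i≤j j≤n))))

  take-drop-middle : (a z b : List A) → take (length z) (drop (length a) (a ++ z ++ b)) ≡ z
  take-drop-middle []      []      b = refl
  take-drop-middle []      (x ∷ z) b = cong (x ∷_) (take-drop-middle [] z b)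
  take-drop-middle (_ ∷ a) z       b = take-drop-middle a z b

  -- A mark at a cut with nothing after it, or one placed a full period into a shorter run, can lie
  -- past the end of `T`. Such marks hit nothing and are filtered out.
  InRange : ℕ → Set
  InRange p = 1 ≤ p × p ≤ length T

  inRange? : ∀ p → Dec (InRange p)
  inRange? p = 1 ≤? p ×-dec p ≤? length T

  -- Positions in Covered are counted from 0, those of a string attractor from 1.
  positions : List ℕ → List ℕ
  positions Γ = filter inRange? (map suc Γ)

  hits⇒substr : ∀ {Γ z} → 0 < length z → Any (λ p → Hits p T z) Γ →
                ∃[ i ] ∃[ j ] ((1 ≤ i) × (i ≤ j) × (j ≤ length T) × (substr T i j ≡ z) ×
                  ∃[ p ] ((p ∈ positions Γ) × (i ≤ p) × (p ≤ j)))
  hits⇒substr {z = z@(x ∷ z′)} _ any with find any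
  ... | p , p∈ , a , b , eq , l , r =
    -- First and last position of the occurrence, counted from 1: the half-open interval counted
    -- from 0 becomes a closed one.
    suc (length a) , length a + length z , s≤s z≤n ,
    ≤-trans (s≤s (m≤m+n _ (length z′))) (≤-reflexive (sym (+-suc (length a) _))) , j≤n ,
    trans (cong₂ take len (cong (drop (length a)) eq)) (take-drop-middle a z b) ,
    suc p , ∈-filter⁺ inRange? (∈-map⁺ suc p∈) (s≤s z≤n , ≤-trans r j≤n) , s≤s l , r
    where
    open ≡-Reasoning
    j≤n : length a + length z ≤ length T
    j≤n = ≤-trans (+-monoʳ-≤ (length a) (m≤m+n (length z) (length b)))
            (≤-reflexive (sym (trans (cong length eq) (trans (length-++ a) (cong (length a +_) (length-++ z))))))
    len : length a + length z ∸ suc (length a) + 1 ≡ length z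
    len = begin
      length a + suc (length z′) ∸ suc (length a) + 1  ≡⟨ cong (λ k → k ∸ suc (length a) + 1) (+-suc (length a) _) ⟩
      length a + length z′ ∸ length a + 1              ≡⟨ cong (_+ 1) (m+n∸m≡n (length a) _) ⟩
      length z′ + 1                                    ≡⟨ +-comm _ 1 ⟩
      suc (length z′)                                  ∎

  covered⇒attractor : ∀ {Γ} → Covered Γ T → IsStringAttractor T (positions Γ)
  covered⇒attractor {Γ} c =
    (λ p∈ → proj₂ (∈-filter⁻ inRange? {xs = map suc Γ} p∈)) ,
    λ i j 1≤i i≤j j≤n → let 0<z = substr-nonempty i j 1≤i i≤j j≤n in
      hits⇒substr 0<z (c _ 0<z (substr-parts T i j))

-- From a collage system to a program

module _ {A : Set} {c : ℕ} (G : Fin c → Rule A c) where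

  -- Used when the derivation meets a symbol again: the word already tabulated for it must be the
  -- one at hand.
  expands-unique : ∀ {X u v} → Expands G X u → Expands G X v → u ≡ v
  expands-unique (e-term p) (e-term q) with refl ← trans (sym p) q = refl
  expands-unique (e-pair p d e) (e-pair q d′ e′) with refl ← trans (sym p) q =
    cong₂ _++_ (expands-unique d d′) (expands-unique e e′)
  expands-unique (e-power {ℓ = ℓ} p d) (e-power q d′) with refl ← trans (sym p) q =
    cong (λ u → pow u ℓ) (expands-unique d d′)
  expands-unique (e-trunc {l = l} {r = r} p d _ _ _) (e-trunc q d′ _ _ _) with refl ← trans (sym p) q =
    cong (λ u → substr u l r) (expands-unique d d′)
  expands-unique (e-term p) (e-pair q _ _) with () ← trans (sym p) q
  expands-unique (e-term p) (e-power q _) with () ← trans (sym p) q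
  expands-unique (e-term p) (e-trunc q _ _ _ _) with () ← trans (sym p) q
  expands-unique (e-pair p _ _) (e-term q) with () ← trans (sym p) q
  expands-unique (e-pair p _ _) (e-power q _) with () ← trans (sym p) q
  expands-unique (e-pair p _ _) (e-trunc q _ _ _ _) with () ← trans (sym p) q
  expands-unique (e-power p _) (e-term q) with () ← trans (sym p) q
  expands-unique (e-power p _) (e-pair q _ _) with () ← trans (sym p) q
  expands-unique (e-power p _) (e-trunc q _ _ _ _) with () ← trans (sym p) q
  expands-unique (e-trunc p _ _ _ _) (e-term q) with () ← trans (sym p) q
  expands-unique (e-trunc p _ _ _ _) (e-pair q _ _) with () ← trans (sym p) q
  expands-unique (e-trunc p _ _ _ _) (e-power q _) with () ← trans (sym p) q

  Entries : Set
  Entries = List (Fin c × List A)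

  -- A derivation may use a symbol many times; keeping the symbols distinct bounds the length by the
  -- number of rules.
  data Table : Entries → Set where
    []  : Table []
    add : ∀ {E X w} → X ∉ map proj₁ E → Expands G X w → Built (map proj₂ E) w → Table E → Table ((X , w) ∷ E)

  table-expands : ∀ {E X w} → Table E → (X , w) ∈ E → Expands G X w
  table-expands (add _ d _ _) (here refl) = d
  table-expands (add _ _ _ t) (there p)   = table-expands t p

  table-program : ∀ {E} → Table E → Program (map proj₂ E)
  table-program []            = []
  table-program (add _ _ b t) = b ∷ table-program t

  table-unique : ∀ {E} → Table E → Unique (map proj₁ E)
  table-unique []            = []
  table-unique (add n _ _ t) = ¬Any⇒All¬ _ n ∷ table-unique t

  record Extension (E : Entries) (X : Fin c) (w : List A) : Set where
    constructor extension
    field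
      {entries} : Entries
      table     : Table entries
      old       : E ⊆ entries
      new       : (X , w) ∈ entries

  insert : ∀ {E X w} → Table E → Expands G X w → Built (map proj₂ E) w → Extension E X w
  insert {E} {X} t d b with member? _≟ᶠ_ X (map proj₁ E)
  ... | no X∉ = extension (add X∉ d b t) there (here refl)
  ... | yes X∈ with (_ , w′) , p , refl ← ∈-map⁻ proj₁ X∈ =
          extension t id (subst (λ v → (X , v) ∈ E) (expands-unique (table-expands t p) d) p)

  -- A postorder walk over the derivation: when a word is inserted, the words it is built from are
  -- already in the table.
  tabulate : (∀ X → RuleOK X (G X)) → ∀ {E X w} → Table E → Expands G X w → Extension E X w
  tabulate wf t d@(e-term _) = insert t d (term _)
  tabulate wf t d@(e-pair _ d₁ d₂)
    with extension t₁ o₁ n₁ ← tabulate wf t d₁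
    with extension t₂ o₂ n₂ ← tabulate wf t₁ d₂
    with extension t₃ o₃ n₃ ← insert t₂ d (pair (∈-map⁺ proj₂ (o₂ n₁)) (∈-map⁺ proj₂ n₂))
    = extension t₃ (o₃ ∘ o₂ ∘ o₁) n₃
  tabulate wf {X = X} t d@(e-power e d₁)
    -- `2 ≤ ℓ` exhibits `ℓ` as a successor, the form that `power` takes.
    with _ , s≤s {n = k} _ ← subst (RuleOK X) e (wf X)
    with extension t₁ o₁ n₁ ← tabulate wf t d₁
    with extension t₂ o₂ n₂ ← insert t₁ d (power k (∈-map⁺ proj₂ n₁))
    = extension t₂ (o₂ ∘ o₁) n₂
  tabulate wf t d@(e-trunc {l = l} {r = r} {u = u} _ d₁ _ _ _)
    with extension t₁ o₁ n₁ ← tabulate wf t d₁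
    with x , y , eq ← substr-parts u l r
    with extension t₂ o₂ n₂ ← insert t₁ d (trunc x y (subst (_∈ _) eq (∈-map⁺ proj₂ n₁)))
    = extension t₂ (o₂ ∘ o₁) n₂

-- Distinct symbols and the final count

unique-lookup : {xs : List A} → Unique xs → ∀ {i j} → lookup xs i ≡ lookup xs j → i ≡ j
unique-lookup (_ ∷ _)  {zero}  {zero}  _  = refl
unique-lookup (p ∷ _)  {zero}  {suc j} eq = contradiction eq (All.lookup p (∈-lookup j))
unique-lookup (p ∷ _)  {suc i} {zero}  eq = contradiction (sym eq) (All.lookup p (∈-lookup i))
unique-lookup (_ ∷ ps) {suc i} {suc j} eq = cong suc (unique-lookup ps eq)

theorem3p5 : {A : Set} (c : ℕ) (C : CollageSystem A c) (T : List A) →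
    Generates C T →
    ∃[ Γ ] ((length Γ ≤ c) × IsStringAttractor T Γ)
theorem3p5 c C T d
  with extension {entries = E} t _ T∈ ← tabulate (CollageSystem.rules C) (CollageSystem.wf C) [] d
  with Γ , b , cov ← cover-whole T (table-program _ t) (∈-map⁺ proj₂ T∈) =
    positions T Γ , size , covered⇒attractor T cov
  where
  open ≤-Reasoning
  size : length (positions T Γ) ≤ c
  size = begin
    length (positions T Γ)  ≤⟨ length-filter (inRange? T) (map suc Γ) ⟩
    length (map suc Γ)      ≡⟨ length-map suc Γ ⟩
    length Γ                ≤⟨ b ⟩
    length (map proj₂ E)    ≡⟨ trans (length-map proj₂ E) (sym (length-map proj₁ E)) ⟩
    -- The symbols in the table are distinct elements of `Fin c`.
    length (map proj₁ E)    ≤⟨ injective⇒≤ (unique-lookup (table-unique _ t)) ⟩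
    c                       ∎
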